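{- Let $n\ge 1$ and consider an inequality in canonical form over $H_n$, $$\sum_{l=1}^{L}\alpha_l S_{I_l}\ \ge\ \sum_{r=1}^{R}\beta_r S_{J_r},\qquad (\ast)$$ where all $\alpha_l,\beta_r>0$, the sets $I_1,\dots,I_L,J_1,\dots,J_R\subseteq[n]$ are distinct and non-empty, and every $i\in[n]$ belongs to at least one of them. The inequality $(\ast)$ is valid for $H_n$ if there exists a $d_\alpha$-$d_\beta$ contraction map $$f: A_n(\mathcal{I}_L)\to \{0,1\}^R$$ satisfying $f(x^{(i)})=y^{(i)}$ for all $i\in[n]\cup\{N\}$.
   Context: For a positive integer $k$ let $[k]=\{1,\dots,k\}$. $K_N$ is the undirected complete graph on vertex set $[N]$, with edge set $E_N$. A weight map is a function $w:E_N\to\mathbb{R}_{\ge 0}$. For $W\subseteq[N]$, the cut $C(W)$ is the set of edges with exactly one endpoint in $W$, and $\|C(W)\|$ is the sum of the weights of its edges. For $n<N$, $w$ realizes in $K_N$ the vector $S=(S_I)_{\varnothing\ne I\subseteq[n]}\in\mathbb{R}^{2^n-1}$ with $S_I=\min\{\|C(W)\| : W\subseteq[N-1],\ W\cap[n]=I\}$. $H_n$ is the set of all $S\in\mathbb{R}^{2^n-1}$ realized by some weight map in $K_N$ for some $N>n$. An inequality is valid for $H_n$ if it is satisfied by all $S\in H_n$. The symbol $N$ also denotes the sink label, which is not an element of $[n]$. Distances: for $\gamma\in\mathbb{R}^m$ with positive entries and $x,x'\in\{0,1\}^m$, $d_\gamma(x,x')=\sum_{k=1}^m\gamma_k|x_k-x'_k|$.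 A map $f$ from a subset of $\{0,1\}^L$ to $\{0,1\}^R$ is a $d_\alpha$-$d_\beta$ contraction map if $d_\beta(f(x),f(x'))\le d_\alpha(x,x')$ for all $x,x'$ in its domain, where $\alpha=(\alpha_1,\dots,\alpha_L)$, $\beta=(\beta_1,\dots,\beta_R)$. Occurrence vectors: for $i\in[n]\cup\{N\}$, $x^{(i)}\in\{0,1\}^L$ has $x^{(i)}_l=1$ if $i\in I_l$ and $0$ otherwise; $y^{(i)}\in\{0,1\}^R$ has $y^{(i)}_r=1$ if $i\in J_r$ and $0$ otherwise. In particular $x^{(N)}$ and $y^{(N)}$ are all-zero. The domain: let $\mathcal{I}_L=\{I_1,\dots,I_L\}$ and, for $x\in\{0,1\}^L$, $\mathcal{I}(x)=\{I_l : x_l=1\}$. $A_n(\mathcal{I}_L)$ is the set of $x\in\{0,1\}^L$ such that $\mathcal{I}(x)$ is pairwise intersecting (any two members have non-empty intersection; the empty family and one-element families count as pairwise intersecting) and is an upper set in $\mathcal{I}_L$ (if $I_l\in\mathcal{I}(x)$ and $I_l\subseteq I_k$ with $k\in[L]$, then $I_k\in\mathcal{I}(x)$). Equivalently, such $x$ correspond to pairwise intersecting antichains in $\mathcal{I}_L$, given by the minimal elements of $\mathcal{I}(x)$. -}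

module Defs where

open import Data.Bool.Base using (Bool; true; false; if_then_else_)
open import Data.Empty using (⊥)
open import Data.Fin.Base as Fin using (Fin; fromℕ)
import Data.Fin.Properties as Fin
open import Data.Fin.Subset using (Subset; inside; outside; _∈_; _∉_; _⊆_; _∩_; Nonempty)
open import Data.Fin.Subset.Properties using (_∈?_; x∈p∩q⁺)
import Data.Integer.Base as ℤ
open import Data.List.Base as List using (List; []; _∷_; _++_; allFin; cartesianProduct; mapMaybe; filter)
open import Data.Maybe.Base using (Maybe; just; nothing)
open import Data.Nat.Base as ℕ using (ℕ; zero; suc; ∣_-_∣)
import Data.Nat.Properties as ℕ
open import Data.Product.Base using (Σ; ∃; _×_; _,_; proj₁; proj₂)
open import Data.Rational.Base as ℚ using (ℚ; 0ℚ; 1ℚ; ½)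
import Data.Rational.Properties as ℚ
open import Data.Rational.Solver using (module +-*-Solver)
open import Data.Sum.Base using (_⊎_; inj₁; inj₂; [_,_])
open import Data.Vec.Base using (Vec; []; _∷_; lookup; tabulate; truncate)
open import Data.Vec.Properties using (≡-dec; lookup∘tabulate; lookup⇒[]=; []=⇒lookup)
import Data.Bool.Properties as Bool
import Data.Vec.Functional as Vector
open import Function.Base using (_∘_)
open import Function.Definitions using (Injective)
open import Relation.Binary.PropositionalEquality using (_≡_; refl; sym; trans; cong; subst)
open import Relation.Nullary.Decidable using (Dec; yes; no; ¬?; _×-dec_; _⊎-dec_)

-- The reals are Cauchy sequences of rationals, with _≃_ as equality; _≤_ is
-- stable under double negation and _<_ carries a positive rational gap.

infix  4 _≤_ _<_ _≃_
infixl 6 _+_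
infixl 7 _*_ _⊓_

Cauchy : (ℕ → ℚ) → Set
Cauchy s = ∀ ε → 0ℚ ℚ.< ε → ∃ λ K → ∀ m n → K ℕ.≤ m → K ℕ.≤ n → ℚ.∣ s m ℚ.- s n ∣ ℚ.≤ ε

record ℝ : Set where
  constructor mkℝ
  field
    seq    : ℕ → ℚ
    cauchy : Cauchy seq

open ℝ public

_≤_ _<_ _≃_ : ℝ → ℝ → Set
x ≤ y = ∀ ε → 0ℚ ℚ.< ε → ∃ λ K → ∀ n → K ℕ.≤ n → seq x n ℚ.≤ seq y n ℚ.+ ε
x < y = ∃ λ ε → 0ℚ ℚ.< ε × ∃ λ K → ∀ n → K ℕ.≤ n → seq x n ℚ.+ ε ℚ.≤ seq y n
x ≃ y = x ≤ y × y ≤ x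

private

  2*½ : ∀ ε → ½ ℚ.* ε ℚ.+ ½ ℚ.* ε ≡ ε
  2*½ ε = trans (sym (ℚ.*-distribʳ-+ ε ½ ½)) (ℚ.*-identityˡ ε)

  0<½* : ∀ {ε} → 0ℚ ℚ.< ε → 0ℚ ℚ.< ½ ℚ.* ε
  0<½* {ε} 0<ε = subst (ℚ._< ½ ℚ.* ε) (ℚ.*-zeroʳ ½) (ℚ.*-monoʳ-<-pos ½ 0<ε)

  p≤∣p∣ : ∀ p → p ℚ.≤ ℚ.∣ p ∣
  p≤∣p∣ p with ℚ.≤-total 0ℚ p
  ... | inj₁ 0≤p = ℚ.≤-reflexive (sym (ℚ.0≤p⇒∣p∣≡p 0≤p))
  ... | inj₂ p≤0 = ℚ.≤-trans p≤0 (ℚ.nonNegative⁻¹ ℚ.∣ p ∣ {{ℚ.∣-∣-nonNeg p}})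

  ∣-∣⇒≤ : ∀ p q {ε} → ℚ.∣ p ℚ.- q ∣ ℚ.≤ ε → p ℚ.≤ q ℚ.+ ε
  ∣-∣⇒≤ p q {ε} h = begin
    p                 ≡⟨ solve 2 (λ p q → p := q :+ (p :- q)) refl p q ⟩
    q ℚ.+ (p ℚ.- q)   ≤⟨ ℚ.+-monoʳ-≤ q (ℚ.≤-trans (p≤∣p∣ (p ℚ.- q)) h) ⟩
    q ℚ.+ ε           ∎
    where open ℚ.≤-Reasoning
          open +-*-Solver

  ≤⇒- : ∀ p q {ε} → p ℚ.≤ q ℚ.+ ε → p ℚ.- q ℚ.≤ ε
  ≤⇒- p q {ε} h = begin
    p ℚ.- q           ≤⟨ ℚ.+-monoˡ-≤ (ℚ.- q) h ⟩
    q ℚ.+ ε ℚ.- q     ≡⟨ solve 2 (λ q ε → q :+ ε :- q := ε) refl q ε ⟩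
    ε                 ∎
    where open ℚ.≤-Reasoning
          open +-*-Solver

  ≤⇒∣-∣ : ∀ p q {ε} → p ℚ.≤ q ℚ.+ ε → q ℚ.≤ p ℚ.+ ε → ℚ.∣ p ℚ.- q ∣ ℚ.≤ ε
  ≤⇒∣-∣ p q {ε} h k with ℚ.∣p∣≡p∨∣p∣≡-p (p ℚ.- q)
  ... | inj₁ e = subst (ℚ._≤ ε) (sym e) (≤⇒- p q h)
  ... | inj₂ e = subst (ℚ._≤ ε) (sym (trans e (solve 2 (λ p q → :- (p :- q) := q :- p) refl p q)))
                       (≤⇒- q p k)
    where open +-*-Solver

  +-cauchy : ∀ x y → Cauchy (λ n → seq x n ℚ.+ seq y n)
  +-cauchy x y ε 0<ε = K₁ ℕ.⊔ K₂ , λ m n m≥ n≥ → begin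
      ℚ.∣ seq x m ℚ.+ seq y m ℚ.- (seq x n ℚ.+ seq y n) ∣
        ≡⟨ cong ℚ.∣_∣ (solve 4 (λ a b c d → a :+ b :- (c :+ d) := (a :- c) :+ (b :- d)) refl
                        (seq x m) (seq y m) (seq x n) (seq y n)) ⟩
      ℚ.∣ (seq x m ℚ.- seq x n) ℚ.+ (seq y m ℚ.- seq y n) ∣
        ≤⟨ ℚ.∣p+q∣≤∣p∣+∣q∣ (seq x m ℚ.- seq x n) (seq y m ℚ.- seq y n) ⟩
      ℚ.∣ seq x m ℚ.- seq x n ∣ ℚ.+ ℚ.∣ seq y m ℚ.- seq y n ∣
        ≤⟨ ℚ.+-mono-≤ (c₁ m n (left m≥) (left n≥)) (c₂ m n (right m≥) (right n≥)) ⟩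
      ½ ℚ.* ε ℚ.+ ½ ℚ.* ε
        ≡⟨ 2*½ ε ⟩
      ε ∎
    where
    open ℚ.≤-Reasoning
    open +-*-Solver
    K₁ = proj₁ (cauchy x (½ ℚ.* ε) (0<½* 0<ε))
    c₁ = proj₂ (cauchy x (½ ℚ.* ε) (0<½* 0<ε))
    K₂ = proj₁ (cauchy y (½ ℚ.* ε) (0<½* 0<ε))
    c₂ = proj₂ (cauchy y (½ ℚ.* ε) (0<½* 0<ε))
    left : ∀ {m} → K₁ ℕ.⊔ K₂ ℕ.≤ m → K₁ ℕ.≤ m
    left = ℕ.≤-trans (ℕ.m≤m⊔n K₁ K₂)
    right : ∀ {m} → K₁ ℕ.⊔ K₂ ℕ.≤ m → K₂ ℕ.≤ m
    right = ℕ.≤-trans (ℕ.m≤n⊔m K₁ K₂)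

  ⊓-close : ∀ a b c d {ε} → a ℚ.≤ c ℚ.+ ε → b ℚ.≤ d ℚ.+ ε → a ℚ.⊓ b ℚ.≤ c ℚ.⊓ d ℚ.+ ε
  ⊓-close a b c d {ε} h k with ℚ.⊓-sel c d
  ... | inj₁ e = ℚ.≤-trans (ℚ.p⊓q≤p a b) (subst (λ z → a ℚ.≤ z ℚ.+ ε) (sym e) h)
  ... | inj₂ e = ℚ.≤-trans (ℚ.p⊓q≤q a b) (subst (λ z → b ℚ.≤ z ℚ.+ ε) (sym e) k)

  ⊓-cauchy : ∀ x y → Cauchy (λ n → seq x n ℚ.⊓ seq y n)
  ⊓-cauchy x y ε 0<ε = K₁ ℕ.⊔ K₂ , λ m n m≥ n≥ →
      ≤⇒∣-∣ (seq x m ℚ.⊓ seq y m) (seq x n ℚ.⊓ seq y n) (close m n m≥ n≥) (close n m n≥ m≥)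
    where
    K₁ = proj₁ (cauchy x ε 0<ε)
    c₁ = proj₂ (cauchy x ε 0<ε)
    K₂ = proj₁ (cauchy y ε 0<ε)
    c₂ = proj₂ (cauchy y ε 0<ε)
    left : ∀ {m} → K₁ ℕ.⊔ K₂ ℕ.≤ m → K₁ ℕ.≤ m
    left = ℕ.≤-trans (ℕ.m≤m⊔n K₁ K₂)
    right : ∀ {m} → K₁ ℕ.⊔ K₂ ℕ.≤ m → K₂ ℕ.≤ m
    right = ℕ.≤-trans (ℕ.m≤n⊔m K₁ K₂)
    close : ∀ m n → K₁ ℕ.⊔ K₂ ℕ.≤ m → K₁ ℕ.⊔ K₂ ℕ.≤ n →
            seq x m ℚ.⊓ seq y m ℚ.≤ seq x n ℚ.⊓ seq y n ℚ.+ ε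
    close m n m≥ n≥ = ⊓-close (seq x m) (seq y m) (seq x n) (seq y n)
                              (∣-∣⇒≤ (seq x m) (seq x n) (c₁ m n (left m≥) (left n≥)))
                              (∣-∣⇒≤ (seq y m) (seq y n) (c₂ m n (right m≥) (right n≥)))

  0<1 : 0ℚ ℚ.< 1ℚ
  0<1 = ℚ.positive⁻¹ 1ℚ

  bounded : ∀ x → ∃ λ B → 0ℚ ℚ.< B × ∃ λ K → ∀ n → K ℕ.≤ n → ℚ.∣ seq x n ∣ ℚ.≤ B
  bounded x = ℚ.∣ seq x K ∣ ℚ.+ 1ℚ , 0<B , K , λ n n≥ → begin
      ℚ.∣ seq x n ∣
        ≡⟨ cong ℚ.∣_∣ (solve 2 (λ p q → p := q :+ (p :- q)) refl (seq x n) (seq x K)) ⟩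
      ℚ.∣ seq x K ℚ.+ (seq x n ℚ.- seq x K) ∣
        ≤⟨ ℚ.∣p+q∣≤∣p∣+∣q∣ (seq x K) (seq x n ℚ.- seq x K) ⟩
      ℚ.∣ seq x K ∣ ℚ.+ ℚ.∣ seq x n ℚ.- seq x K ∣
        ≤⟨ ℚ.+-monoʳ-≤ ℚ.∣ seq x K ∣ (c n K n≥ ℕ.≤-refl) ⟩
      ℚ.∣ seq x K ∣ ℚ.+ 1ℚ ∎
    where
    open ℚ.≤-Reasoning
    open +-*-Solver
    K = proj₁ (cauchy x 1ℚ 0<1)
    c = proj₂ (cauchy x 1ℚ 0<1)
    0<B : 0ℚ ℚ.< ℚ.∣ seq x K ∣ ℚ.+ 1ℚ
    0<B = ℚ.+-mono-≤-< (ℚ.nonNegative⁻¹ ℚ.∣ seq x K ∣ {{ℚ.∣-∣-nonNeg (seq x K)}}) 0<1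

  divide : ∀ {B ε} → 0ℚ ℚ.< B → 0ℚ ℚ.< ε → ∃ λ δ → 0ℚ ℚ.< δ × B ℚ.* δ ≡ ε
  divide {B} {ε} 0<B 0<ε = ℚ.1/ B ℚ.* ε , 0<δ ,
    trans (sym (ℚ.*-assoc B (ℚ.1/ B) ε))
          (trans (cong (ℚ._* ε) (ℚ.*-inverseʳ B)) (ℚ.*-identityˡ ε))
    where
    instance
      B>0 : ℚ.Positive B
      B>0 = ℚ.positive 0<B
      B≢0 : ℚ.NonZero B
      B≢0 = ℚ.pos⇒nonZero B
      1/B>0 : ℚ.Positive (ℚ.1/ B)
      1/B>0 = ℚ.1/pos⇒pos B
    0<δ : 0ℚ ℚ.< ℚ.1/ B ℚ.* ε
    0<δ = subst (ℚ._< ℚ.1/ B ℚ.* ε) (ℚ.*-zeroʳ (ℚ.1/ B)) (ℚ.*-monoʳ-<-pos (ℚ.1/ B) 0<ε)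

  ∣*∣≤ : ∀ p q {b d} → 0ℚ ℚ.< b → ℚ.∣ p ∣ ℚ.≤ b → ℚ.∣ q ∣ ℚ.≤ d → ℚ.∣ p ℚ.* q ∣ ℚ.≤ b ℚ.* d
  ∣*∣≤ p q {b} {d} 0<b p≤b q≤d = begin
    ℚ.∣ p ℚ.* q ∣          ≡⟨ ℚ.∣p*q∣≡∣p∣*∣q∣ p q ⟩
    ℚ.∣ p ∣ ℚ.* ℚ.∣ q ∣    ≤⟨ ℚ.*-monoʳ-≤-nonNeg ℚ.∣ q ∣ {{ℚ.∣-∣-nonNeg q}} p≤b ⟩
    b ℚ.* ℚ.∣ q ∣          ≤⟨ ℚ.*-monoˡ-≤-nonNeg b {{ℚ.nonNegative (ℚ.<⇒≤ 0<b)}} q≤d ⟩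
    b ℚ.* d                ∎
    where open ℚ.≤-Reasoning

  *-close : ∀ a b c d {B B′ δ} → 0ℚ ℚ.< B → 0ℚ ℚ.< B′ → ℚ.∣ a ∣ ℚ.≤ B → ℚ.∣ d ∣ ℚ.≤ B′ →
            ℚ.∣ a ℚ.- c ∣ ℚ.≤ δ → ℚ.∣ b ℚ.- d ∣ ℚ.≤ δ →
            ℚ.∣ a ℚ.* b ℚ.- c ℚ.* d ∣ ℚ.≤ (B ℚ.+ B′) ℚ.* δ
  *-close a b c d {B} {B′} {δ} 0<B 0<B′ a≤B d≤B′ a-c b-d = begin
    ℚ.∣ a ℚ.* b ℚ.- c ℚ.* d ∣
      ≡⟨ cong ℚ.∣_∣ (solve 4 (λ a b c d → a :* b :- c :* d := a :* (b :- d) :+ d :* (a :- c)) refl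
                      a b c d) ⟩
    ℚ.∣ a ℚ.* (b ℚ.- d) ℚ.+ d ℚ.* (a ℚ.- c) ∣
      ≤⟨ ℚ.∣p+q∣≤∣p∣+∣q∣ (a ℚ.* (b ℚ.- d)) (d ℚ.* (a ℚ.- c)) ⟩
    ℚ.∣ a ℚ.* (b ℚ.- d) ∣ ℚ.+ ℚ.∣ d ℚ.* (a ℚ.- c) ∣
      ≤⟨ ℚ.+-mono-≤ (∣*∣≤ a (b ℚ.- d) 0<B a≤B b-d) (∣*∣≤ d (a ℚ.- c) 0<B′ d≤B′ a-c) ⟩
    B ℚ.* δ ℚ.+ B′ ℚ.* δ
      ≡⟨ ℚ.*-distribʳ-+ δ B B′ ⟨
    (B ℚ.+ B′) ℚ.* δ ∎
    where open ℚ.≤-Reasoning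
          open +-*-Solver

  *-cauchy : ∀ x y → Cauchy (λ n → seq x n ℚ.* seq y n)
  *-cauchy x y ε 0<ε =
    let Bx , 0<Bx , Kx , bx = bounded x
        By , 0<By , Ky , by = bounded y
        δ , 0<δ , Bδ≡ε      = divide (ℚ.+-mono-< 0<Bx 0<By) 0<ε
        K₁ , c₁             = cauchy x δ 0<δ
        K₂ , c₂             = cauchy y δ 0<δ
        x≤K = ℕ.≤-trans (ℕ.m≤m⊔n Kx Ky) (ℕ.m≤m⊔n (Kx ℕ.⊔ Ky) (K₁ ℕ.⊔ K₂))
        y≤K = ℕ.≤-trans (ℕ.m≤n⊔m Kx Ky) (ℕ.m≤m⊔n (Kx ℕ.⊔ Ky) (K₁ ℕ.⊔ K₂))
        1≤K = ℕ.≤-trans (ℕ.m≤m⊔n K₁ K₂) (ℕ.m≤n⊔m (Kx ℕ.⊔ Ky) (K₁ ℕ.⊔ K₂))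
        2≤K = ℕ.≤-trans (ℕ.m≤n⊔m K₁ K₂) (ℕ.m≤n⊔m (Kx ℕ.⊔ Ky) (K₁ ℕ.⊔ K₂))
    in (Kx ℕ.⊔ Ky) ℕ.⊔ (K₁ ℕ.⊔ K₂) , λ m n m≥ n≥ →
       subst (ℚ.∣ seq x m ℚ.* seq y m ℚ.- seq x n ℚ.* seq y n ∣ ℚ.≤_) Bδ≡ε
         (*-close (seq x m) (seq y m) (seq x n) (seq y n) 0<Bx 0<By
           (bx m (ℕ.≤-trans x≤K m≥)) (by n (ℕ.≤-trans y≤K n≥))
           (c₁ m n (ℕ.≤-trans 1≤K m≥) (ℕ.≤-trans 1≤K n≥))
           (c₂ m n (ℕ.≤-trans 2≤K m≥) (ℕ.≤-trans 2≤K n≥)))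

_+_ _*_ _⊓_ : ℝ → ℝ → ℝ
x + y = mkℝ (λ n → seq x n ℚ.+ seq y n) (+-cauchy x y)
x * y = mkℝ (λ n → seq x n ℚ.* seq y n) (*-cauchy x y)
x ⊓ y = mkℝ (λ n → seq x n ℚ.⊓ seq y n) (⊓-cauchy x y)

fromℚ : ℚ → ℝ
fromℚ q = mkℝ (λ _ → q) λ ε 0<ε →
  0 , λ _ _ _ _ → subst (ℚ._≤ ε) (sym (cong ℚ.∣_∣ (ℚ.+-inverseʳ q))) (ℚ.<⇒≤ 0<ε)

0ℝ : ℝ
0ℝ = fromℚ 0ℚ

natToℝ : ℕ → ℝ
natToℝ k = fromℚ (ℤ.+ k ℚ./ 1)

∑ : ∀ {m} → (Fin m → ℝ) → ℝ
∑ = Vector.foldr _+_ 0ℝ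

∑ˡ : List ℝ → ℝ
∑ˡ = List.foldr _+_ 0ℝ

-- The empty list has no minimum.
_IsMinimumOf_ : ℝ → List ℝ → Set
s IsMinimumOf []       = ⊥
s IsMinimumOf (r ∷ rs) = s ≃ List.foldr _⊓_ r rs

-- An undirected edge is listed once, by its endpoints in increasing order.
record Edge (N : ℕ) : Set where
  constructor edge
  field
    lo hi  : Fin N
    .lo<hi : lo Fin.< hi

open Edge public

edges : ∀ N → List (Edge N)
edges N = mapMaybe toEdge (cartesianProduct (allFin N) (allFin N))
  where
  toEdge : Fin N × Fin N → Maybe (Edge N)
  toEdge (i , j) with i Fin.<? j
  ... | yes i<j = just (edge i j i<j)
  ... | no  _   = nothing

record WeightMap (N : ℕ) : Set where
  field
    weight : Edge N → ℝ
    nonneg : ∀ e → 0ℝ ≤ weight e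

open WeightMap public

InCut : ∀ {N} → Subset N → Edge N → Set
InCut W e = (lo e ∈ W × hi e ∉ W) ⊎ (lo e ∉ W × hi e ∈ W)

inCut? : ∀ {N} (W : Subset N) (e : Edge N) → Dec (InCut W e)
inCut? W e = (lo e ∈? W ×-dec ¬? (hi e ∈? W)) ⊎-dec (¬? (lo e ∈? W) ×-dec hi e ∈? W)

cutWeight : ∀ {N} → WeightMap N → Subset N → ℝ
cutWeight {N} w W = ∑ˡ (List.map (weight w) (filter (inCut? W) (edges N)))

subsets : ∀ N → List (Subset N)
subsets zero    = [] ∷ []
subsets (suc N) = List.map (outside ∷_) (subsets N) ++ List.map (inside ∷_) (subsets N)

record NonemptySubset (n : ℕ) : Set where
  constructor _,⁺_
  field
    set       : Subset n
    .nonempty : Nonempty set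

open NonemptySubset public

CutVector : ℕ → Set
CutVector n = NonemptySubset n → ℝ

-- As 0 ≤ n < N, write N = suc M. The vertices of K_N are the elements of
-- Fin (suc M), with [n] as the first n of them; the last one, fromℕ M, is the
-- sink, so W ⊆ [N − 1] says that W avoids it.  The truncation is W ∩ [n].
Admissible : ∀ {n M} → n ℕ.< suc M → Subset n → Subset (suc M) → Set
Admissible {M = M} n<N I W = fromℕ M ∉ W × truncate (ℕ.<⇒≤ n<N) W ≡ I

admissible? : ∀ {n M} (n<N : n ℕ.< suc M) (I : Subset n) (W : Subset (suc M)) →
              Dec (Admissible n<N I W)
admissible? {M = M} n<N I W = ¬? (fromℕ M ∈? W) ×-dec ≡-dec Bool._≟_ (truncate (ℕ.<⇒≤ n<N) W) I

Realizes : ∀ {n M} → n ℕ.< suc M → WeightMap (suc M) → CutVector n → Set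
Realizes {M = M} n<N w S = ∀ I →
  S I IsMinimumOf List.map (cutWeight w) (filter (admissible? n<N (set I)) (subsets (suc M)))

H : ∀ n → CutVector n → Set
H n S = ∃ λ M → Σ (n ℕ.< suc M) λ n<N → ∃ λ (w : WeightMap (suc M)) → Realizes n<N w S

record CanonicalInequality (n : ℕ) : Set where
  field
    L R      : ℕ
    α        : Fin L → ℝ
    β        : Fin R → ℝ
    I        : Fin L → NonemptySubset n
    J        : Fin R → NonemptySubset n
    α-pos    : ∀ l → 0ℝ < α l
    β-pos    : ∀ r → 0ℝ < β r
    distinct : Injective _≡_ _≡_ [ I , J ]
    covers   : ∀ i → (∃ λ l → i ∈ set (I l)) ⊎ (∃ λ r → i ∈ set (J r))

  Satisfies : CutVector n → Set
  Satisfies S = ∑ (λ r → β r * S (J r)) ≤ ∑ (λ l → α l * S (I l))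

  Valid : Set
  Valid = ∀ S → H n S → Satisfies S

bit : Bool → ℕ
bit b = if b then 1 else 0

dist : ∀ {m} → (Fin m → ℝ) → Vec Bool m → Vec Bool m → ℝ
dist γ x x′ = ∑ λ k → γ k * natToℝ ∣ bit (lookup x k) - bit (lookup x′ k) ∣

data Label (n : ℕ) : Set where
  terminal : Fin n → Label n
  sink     : Label n

occurs : ∀ {n} → Label n → Subset n → Bool
occurs (terminal i) I = lookup I i
occurs sink         I = false

occurrence : ∀ {n m} → (Fin m → NonemptySubset n) → Label n → Vec Bool m
occurrence I i = tabulate λ l → occurs i (set (I l))

-- A bit vector x is read as the subset { l | x_l = 1 } of the indices.
PairwiseIntersecting UpperSet : ∀ {n L} → (Fin L → NonemptySubset n) → Vec Bool L → Set
PairwiseIntersecting I x = ∀ l k → l ∈ x → k ∈ x → Nonempty (set (I l) ∩ set (I k))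
UpperSet             I x = ∀ l k → l ∈ x → set (I l) ⊆ set (I k) → k ∈ x

-- The membership proofs are irrelevant, so that functions on A I are
-- functions of the bit vector alone.
record A {n L : ℕ} (I : Fin L → NonemptySubset n) : Set where
  constructor mkA
  field
    vec           : Vec Bool L
    .intersecting : PairwiseIntersecting I vec
    .upper        : UpperSet I vec

open A public

private

  ∈-occurrence⁻ : ∀ {n m} (I : Fin m → NonemptySubset n) i {l} →
                  l ∈ occurrence I i → occurs i (set (I l)) ≡ true
  ∈-occurrence⁻ I i {l} l∈ = trans (sym (lookup∘tabulate _ l)) ([]=⇒lookup l∈)

  ∈-occurrence⁺ : ∀ {n m} (I : Fin m → NonemptySubset n) i {l} →
                  occurs i (set (I l)) ≡ true → l ∈ occurrence I i
  ∈-occurrence⁺ I i {l} e = lookup⇒[]= l _ (trans (lookup∘tabulate _ l) e)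

  occurrence-intersecting : ∀ {n L} (I : Fin L → NonemptySubset n) i →
                            PairwiseIntersecting I (occurrence I i)
  occurrence-intersecting I (terminal i) l k l∈ k∈ =
    i , x∈p∩q⁺ ( lookup⇒[]= i _ (∈-occurrence⁻ I (terminal i) l∈)
               , lookup⇒[]= i _ (∈-occurrence⁻ I (terminal i) k∈))
  occurrence-intersecting I sink l k l∈ k∈ with ∈-occurrence⁻ I sink l∈
  ... | ()

  occurrence-upper : ∀ {n L} (I : Fin L → NonemptySubset n) i → UpperSet I (occurrence I i)
  occurrence-upper I (terminal i) l k l∈ I⊆ = ∈-occurrence⁺ I (terminal i)
    ([]=⇒lookup (I⊆ (lookup⇒[]= i _ (∈-occurrence⁻ I (terminal i) l∈))))
  occurrence-upper I sink l k l∈ I⊆ with ∈-occurrence⁻ I sink l∈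
  ... | ()

occurrenceA : ∀ {n L} (I : Fin L → NonemptySubset n) → Label n → A I
occurrenceA I i = mkA (occurrence I i) (occurrence-intersecting I i) (occurrence-upper I i)

module _ {n : ℕ} (Q : CanonicalInequality n) where
  open CanonicalInequality Q

  IsContraction : (A I → Vec Bool R) → Set
  IsContraction f = ∀ x x′ → dist β (f x) (f x′) ≤ dist α (vec x) (vec x′)

  RespectsOccurrences : (A I → Vec Bool R) → Set
  RespectsOccurrences f = ∀ i → f (occurrenceA I i) ≡ occurrence J i

{-# OPTIONS --safe #-}

-- Among the minimum-weight cuts for I_l choose W_l of least cardinality. By
-- submodularity I_l ⊆ I_k forces W_l ⊆ W_k, and by posimodularity disjoint I_l
-- and I_k have disjoint W_l and W_k; so the bits of a vertex v, recording which
-- W_l contain it, form an element x(v) of the domain A. The sets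
-- U_r = { v | f(x(v))_r = 1 } are then cuts for the J_r, and summing the
-- contraction inequality for x(u), x(v) over the weighted edges uv gives
-- ∑ β_r ‖C(U_r)‖ ≤ ∑ α_l ‖C(W_l)‖. The choice of W_l compares real numbers,
-- which is harmless: _≤_ is stable under double negation.

module Submission where

open import Defs
open import Data.Bool.Base using (Bool; true; false; not; _∧_; _∨_)
import Data.Bool.Properties as Bool
open import Data.Empty using (⊥; ⊥-elim)
open import Data.Fin.Base as Fin using (Fin; fromℕ; inject≤)
import Data.Fin.Properties as Fin
open import Data.Fin.Subset using (Subset; inside; outside; ∣_∣; _⊆_; _∩_; Nonempty)
  renaming (_∈_ to _∈ₛ_)
open import Data.Fin.Subset.Properties using (nonempty?; _∈?_; p⊂q⇒∣p∣<∣q∣; x∈p∩q⁺)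
import Data.Integer.Base as ℤ
open import Data.List.Base as List using (List; []; _∷_; filter)
open import Data.List.Membership.Propositional using (_∈_)
open import Data.List.Membership.Propositional.Properties
  using (∈-map⁺; ∈-map⁻; ∈-++⁺ˡ; ∈-++⁺ʳ; ∈-filter⁺; ∈-filter⁻)
open import Data.List.Properties using (filter-accept; filter-reject)
open import Data.List.Relation.Unary.Any using (here; there)
open import Data.Nat.Base as ℕ using (ℕ)
import Data.Nat.Properties as ℕ
open import Data.Product.Base using (∃; _×_; _,_; proj₁; proj₂)
open import Data.Rational.Base as ℚ using (ℚ; 0ℚ; 1ℚ)
import Data.Rational.Properties as ℚ
open import Data.Rational.Solver using (module +-*-Solver)
open import Data.Sum.Base as Sum using (_⊎_; inj₁; inj₂; [_,_]′)
open import Data.Vec.Base using (Vec; []; _∷_; lookup; tabulate; truncate; zipWith)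
import Data.Vec.Functional as Vector
open import Data.Vec.Properties
  using (lookup∘tabulate; tabulate∘lookup; tabulate-cong; lookup-zipWith; lookup⇒[]=; []=⇒lookup)
open import Effect.Monad using (RawMonad)
open import Function.Base using (_∘_; id)
import Level
open import Relation.Binary.Bundles using (Poset)
open import Relation.Binary.PropositionalEquality
  using (_≡_; refl; sym; trans; cong; cong₂; subst; module ≡-Reasoning)
import Relation.Binary.Reasoning.PartialOrder as PosetReasoning
open import Relation.Nullary using (¬_; Dec; yes; no; contradiction; Stable)
open import Relation.Nullary.Decidable
  using (map′; decidable-stable; _×-dec_; from-yes; ¬¬-excluded-middle)
open import Relation.Nullary.Negation using (¬¬-Monad; ¬¬-map)
open CanonicalInequality using (I; R; Valid)

-- The order on ℝ

0<1 : 0ℚ ℚ.< 1ℚ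
0<1 = ℚ.positive⁻¹ 1ℚ

divide : ∀ {b ε} → 0ℚ ℚ.< b → 0ℚ ℚ.< ε → ∃ λ δ → 0ℚ ℚ.< δ × b ℚ.* δ ≡ ε
divide {b} {ε} 0<b 0<ε =
  ℚ.1/ b ℚ.* ε ,
  ℚ.positive⁻¹ _ {{ℚ.pos*pos⇒pos (ℚ.1/ b) {{ℚ.1/pos⇒pos b}} ε {{ℚ.positive 0<ε}}}} ,
  trans (sym (ℚ.*-assoc b (ℚ.1/ b) ε)) (trans (cong (ℚ._* ε) (ℚ.*-inverseʳ b)) (ℚ.*-identityˡ ε))
  where
  instance
    _ = ℚ.positive 0<b
    _ = ℚ.pos⇒nonZero b

p-q≤r⇒p≤q+r : ∀ p q {r} → p ℚ.- q ℚ.≤ r → p ℚ.≤ q ℚ.+ r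
p-q≤r⇒p≤q+r p q {r} h = subst (ℚ._≤ q ℚ.+ r)
  (solve 2 (λ p q → q :+ (p :- q) := p) refl p q) (ℚ.+-monoʳ-≤ q h)
  where open +-*-Solver

p≤∣p∣ : ∀ p → p ℚ.≤ ℚ.∣ p ∣
p≤∣p∣ p with ℚ.≤-total 0ℚ p
... | inj₁ 0≤p = ℚ.≤-reflexive (sym (ℚ.0≤p⇒∣p∣≡p 0≤p))
... | inj₂ p≤0 = ℚ.≤-trans p≤0 (ℚ.0≤∣p∣ p)

eventually-near : ∀ x {ε} → 0ℚ ℚ.< ε → ∃ λ K → ∀ m n → K ℕ.≤ m → K ℕ.≤ n →
                  seq x m ℚ.≤ seq x n ℚ.+ ε
eventually-near x 0<ε with cauchy x _ 0<ε
... | K , near = K , λ m n m≥K n≥K →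
  p-q≤r⇒p≤q+r (seq x m) (seq x n) (ℚ.≤-trans (p≤∣p∣ _) (near m n m≥K n≥K))

eventually-both : ∀ {P Q : ℕ → Set} → (∃ λ K → ∀ n → K ℕ.≤ n → P n) →
                  (∃ λ K → ∀ n → K ℕ.≤ n → Q n) → ∃ λ K → ∀ n → K ℕ.≤ n → P n × Q n
eventually-both (K , p) (L , q) = K ℕ.⊔ L , λ n n≥ →
  p n (ℕ.≤-trans (ℕ.m≤m⊔n K L) n≥) , q n (ℕ.≤-trans (ℕ.m≤n⊔m K L) n≥)

pointwise⇒≤ : ∀ x y → (∀ n → seq x n ℚ.≤ seq y n) → x ≤ y
pointwise⇒≤ x y h ε 0<ε = 0 , λ n _ → ℚ.≤-trans (h n)
  (subst (ℚ._≤ seq y n ℚ.+ ε) (ℚ.+-identityʳ (seq y n)) (ℚ.+-monoʳ-≤ (seq y n) (ℚ.<⇒≤ 0<ε)))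

pointwise⇒≃ : ∀ x y → (∀ n → seq x n ≡ seq y n) → x ≃ y
pointwise⇒≃ x y h = pointwise⇒≤ x y (ℚ.≤-reflexive ∘ h) , pointwise⇒≤ y x (ℚ.≤-reflexive ∘ sym ∘ h)

-- Both hypotheses are used at tolerance δ = ε/2, which leaves a loss of 2δ for the conclusion.
-- Transitivity, addition and cancellation thereby become rational inequalities at a single index.
infer-≤ : ∀ x y u v p q →
          (∀ n δ → seq x n ℚ.≤ seq y n ℚ.+ δ → seq u n ℚ.≤ seq v n ℚ.+ δ →
                   seq p n ℚ.≤ seq q n ℚ.+ (1ℚ ℚ.+ 1ℚ) ℚ.* δ) →
          x ≤ y → u ≤ v → p ≤ q
infer-≤ x y u v p q h x≤y u≤v ε 0<ε with divide (ℚ.+-mono-< 0<1 0<1) 0<ε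
... | δ , 0<δ , refl with eventually-both (x≤y δ 0<δ) (u≤v δ 0<δ)
... | K , near = K , λ n n≥K → h n δ (proj₁ (near n n≥K)) (proj₂ (near n n≥K))

≤-refl : ∀ x → x ≤ x
≤-refl x = pointwise⇒≤ x x λ _ → ℚ.≤-refl

≤-trans : ∀ x y z → x ≤ y → y ≤ z → x ≤ z
≤-trans x y z = infer-≤ x y y z x z λ n δ h k → begin
  seq x n                              ≤⟨ h ⟩
  seq y n ℚ.+ δ                        ≤⟨ ℚ.+-monoˡ-≤ δ k ⟩
  seq z n ℚ.+ δ ℚ.+ δ
    ≡⟨ solve 2 (λ z d → z :+ d :+ d := z :+ (con 1ℚ :+ con 1ℚ) :* d) refl (seq z n) δ ⟩
  seq z n ℚ.+ (1ℚ ℚ.+ 1ℚ) ℚ.* δ        ∎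
  where open ℚ.≤-Reasoning
        open +-*-Solver

+-mono-≤ : ∀ x y u v → x ≤ y → u ≤ v → x + u ≤ y + v
+-mono-≤ x y u v = infer-≤ x y u v (x + u) (y + v) λ n δ h k → begin
  seq x n ℚ.+ seq u n                            ≤⟨ ℚ.+-mono-≤ h k ⟩
  (seq y n ℚ.+ δ) ℚ.+ (seq v n ℚ.+ δ)
    ≡⟨ solve 3 (λ y v d → (y :+ d) :+ (v :+ d) := y :+ v :+ (con 1ℚ :+ con 1ℚ) :* d)
             refl (seq y n) (seq v n) δ ⟩
  seq y n ℚ.+ seq v n ℚ.+ (1ℚ ℚ.+ 1ℚ) ℚ.* δ      ∎
  where open ℚ.≤-Reasoning
        open +-*-Solver

-- The cancelled terms need only satisfy `v ≤ u`, which is what uncrossing supplies: one new cut is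
-- at least as heavy as the old one it replaces, so the other is at most as heavy as its
-- counterpart.
+-cancel-≤ : ∀ x y u v → x + u ≤ y + v → v ≤ u → x ≤ y
+-cancel-≤ x y u v = infer-≤ (x + u) (y + v) v u x y λ n δ h k → begin
  seq x n
    ≡⟨ solve 2 (λ x u → x := x :+ u :- u) refl (seq x n) (seq u n) ⟩
  seq x n ℚ.+ seq u n ℚ.- seq u n
    ≤⟨ ℚ.+-monoˡ-≤ (ℚ.- seq u n) (ℚ.≤-trans h (ℚ.+-monoˡ-≤ δ (ℚ.+-monoʳ-≤ (seq y n) k))) ⟩
  seq y n ℚ.+ (seq u n ℚ.+ δ) ℚ.+ δ ℚ.- seq u n
    ≡⟨ solve 3 (λ y u d → y :+ (u :+ d) :+ d :- u := y :+ (con 1ℚ :+ con 1ℚ) :* d)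
             refl (seq y n) (seq u n) δ ⟩
  seq y n ℚ.+ (1ℚ ℚ.+ 1ℚ) ℚ.* δ ∎
  where open ℚ.≤-Reasoning
        open +-*-Solver

⊓-glb : ∀ x y z → z ≤ x → z ≤ y → z ≤ x ⊓ y
⊓-glb x y z z≤x z≤y ε 0<ε with eventually-both (z≤x ε 0<ε) (z≤y ε 0<ε)
... | K , near = K , λ n n≥K → below n (near n n≥K)
  where
  below : ∀ n → seq z n ℚ.≤ seq x n ℚ.+ ε × seq z n ℚ.≤ seq y n ℚ.+ ε →
          seq z n ℚ.≤ seq x n ℚ.⊓ seq y n ℚ.+ ε
  below n (h , k) with ℚ.⊓-sel (seq x n) (seq y n)
  ... | inj₁ e = subst (λ m → seq z n ℚ.≤ m ℚ.+ ε) (sym e) h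
  ... | inj₂ e = subst (λ m → seq z n ℚ.≤ m ℚ.+ ε) (sym e) k

eventually-bounded : ∀ x → ∃ λ b → 0ℚ ℚ.< b × ∃ λ K → ∀ n → K ℕ.≤ n → seq x n ℚ.≤ b
eventually-bounded x = ℚ.∣ seq x K ∣ ℚ.+ 1ℚ , 0<b , K , λ n n≥K → begin
  seq x n                  ≤⟨ proj₂ near n K n≥K ℕ.≤-refl ⟩
  seq x K ℚ.+ 1ℚ           ≤⟨ ℚ.+-monoˡ-≤ 1ℚ (p≤∣p∣ (seq x K)) ⟩
  ℚ.∣ seq x K ∣ ℚ.+ 1ℚ     ∎
  where
  open ℚ.≤-Reasoning
  near = eventually-near x 0<1
  K = proj₁ near
  0<b : 0ℚ ℚ.< ℚ.∣ seq x K ∣ ℚ.+ 1ℚ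
  0<b = ℚ.+-mono-≤-< {0ℚ} {ℚ.∣ seq x K ∣} {0ℚ} {1ℚ} (ℚ.0≤∣p∣ (seq x K)) 0<1

0≤q-p : ∀ {p q} → p ℚ.≤ q → 0ℚ ℚ.≤ q ℚ.- p
0≤q-p {p} {q} p≤q = subst (ℚ._≤ q ℚ.- p) (ℚ.+-inverseʳ p) (ℚ.+-monoˡ-≤ (ℚ.- p) p≤q)

0≤p*q : ∀ {p q} → 0ℚ ℚ.≤ p → 0ℚ ℚ.≤ q → 0ℚ ℚ.≤ p ℚ.* q
0≤p*q {p} {q} 0≤p 0≤q = subst (ℚ._≤ p ℚ.* q) (ℚ.*-zeroʳ p)
  (ℚ.*-monoˡ-≤-nonNeg p {{ℚ.nonNegative 0≤p}} 0≤q)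

-- The sign of `q` decides how the right-hand side splits into products of nonnegative factors:
-- around `(p + δ) q` if `q` is nonnegative, around `(b − p)(−q)` otherwise.
*-lower-bound : ∀ p q {b c δ} → p ℚ.≤ b → q ℚ.≤ c → 0ℚ ℚ.≤ b → 0ℚ ℚ.≤ c → 0ℚ ℚ.≤ δ →
                0ℚ ℚ.≤ p ℚ.+ δ → 0ℚ ℚ.≤ q ℚ.+ δ → 0ℚ ℚ.≤ p ℚ.* q ℚ.+ (b ℚ.+ c) ℚ.* δ
*-lower-bound p q {b} {c} {δ} p≤b q≤c 0≤b 0≤c 0≤δ 0≤p+δ 0≤q+δ with ℚ.≤-total 0ℚ q
... | inj₁ 0≤q = begin
  0ℚ
    ≤⟨ ℚ.+-mono-≤ (0≤p*q 0≤p+δ 0≤q) (0≤p*q (ℚ.+-mono-≤ (0≤q-p q≤c) 0≤b) 0≤δ) ⟩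
  (p ℚ.+ δ) ℚ.* q ℚ.+ (c ℚ.- q ℚ.+ b) ℚ.* δ
    ≡⟨ solve 5 (λ p q b c d → (p :+ d) :* q :+ (c :- q :+ b) :* d := p :* q :+ (b :+ c) :* d)
             refl p q b c δ ⟩
  p ℚ.* q ℚ.+ (b ℚ.+ c) ℚ.* δ ∎
  where open ℚ.≤-Reasoning
        open +-*-Solver
... | inj₂ q≤0 = begin
  0ℚ
    ≤⟨ ℚ.+-mono-≤ (ℚ.+-mono-≤ (0≤p*q (0≤q-p p≤b) (0≤q-p q≤0)) (0≤p*q 0≤b 0≤q+δ)) (0≤p*q 0≤c 0≤δ) ⟩
  (b ℚ.- p) ℚ.* (0ℚ ℚ.- q) ℚ.+ b ℚ.* (q ℚ.+ δ) ℚ.+ c ℚ.* δ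
    ≡⟨ solve 5 (λ p q b c d → (b :- p) :* (con 0ℚ :- q) :+ b :* (q :+ d) :+ c :* d
              := p :* q :+ (b :+ c) :* d)
             refl p q b c δ ⟩
  p ℚ.* q ℚ.+ (b ℚ.+ c) ℚ.* δ ∎
  where open ℚ.≤-Reasoning
        open +-*-Solver

*-monoʳ-≤ : ∀ a x y → 0ℝ ≤ a → x ≤ y → a * x ≤ a * y
*-monoʳ-≤ a x y 0≤a x≤y ε 0<ε =
  -- The factors `a` and `y − x` are eventually at least -δ and at most b and c, so their product is
  -- eventually at least -(b + c)δ; hence the choice δ = ε/(b + c).
  let b , 0<b , a≤b   = eventually-bounded a
      c , 0<c , t≤c   = eventually-bounded (y + fromℚ (ℚ.- 1ℚ) * x)
      δ , 0<δ , bcδ≡ε = divide (ℚ.+-mono-< 0<b 0<c) 0<ε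
      K , near        = eventually-both (eventually-both a≤b t≤c)
                                        (eventually-both (0≤a δ 0<δ) (x≤y δ 0<δ))
  in K , λ n n≥K →
     let (a≤b , t≤c) , (0≤a+δ , x≤y+δ) = near n n≥K
     in subst (λ e → seq a n ℚ.* seq x n ℚ.≤ seq a n ℚ.* seq y n ℚ.+ e) bcδ≡ε
          (below (seq a n) (seq x n) (seq y n) a≤b t≤c
                 (ℚ.<⇒≤ 0<b) (ℚ.<⇒≤ 0<c) (ℚ.<⇒≤ 0<δ) 0≤a+δ x≤y+δ)
  where
  open ℚ.≤-Reasoning
  open +-*-Solver
  below : ∀ p q r {b c δ} → p ℚ.≤ b → r ℚ.+ (ℚ.- 1ℚ) ℚ.* q ℚ.≤ c → 0ℚ ℚ.≤ b → 0ℚ ℚ.≤ c →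
          0ℚ ℚ.≤ δ → 0ℚ ℚ.≤ p ℚ.+ δ → q ℚ.≤ r ℚ.+ δ → p ℚ.* q ℚ.≤ p ℚ.* r ℚ.+ (b ℚ.+ c) ℚ.* δ
  below p q r {b} {c} {δ} p≤b t≤c 0≤b 0≤c 0≤δ 0≤p+δ q≤r+δ = begin
    p ℚ.* q
      ≡⟨ ℚ.+-identityʳ (p ℚ.* q) ⟨
    p ℚ.* q ℚ.+ 0ℚ
      ≤⟨ ℚ.+-monoʳ-≤ (p ℚ.* q) (*-lower-bound p t p≤b t≤c 0≤b 0≤c 0≤δ 0≤p+δ 0≤t+δ) ⟩
    p ℚ.* q ℚ.+ (p ℚ.* t ℚ.+ (b ℚ.+ c) ℚ.* δ)
      ≡⟨ solve 4 (λ p q r e → p :* q :+ (p :* (r :+ con (ℚ.- 1ℚ) :* q) :+ e) := p :* r :+ e) refl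
               p q r ((b ℚ.+ c) ℚ.* δ) ⟩
    p ℚ.* r ℚ.+ (b ℚ.+ c) ℚ.* δ ∎
    where
    t = r ℚ.+ (ℚ.- 1ℚ) ℚ.* q
    0≤t+δ : 0ℚ ℚ.≤ t ℚ.+ δ
    0≤t+δ = subst (0ℚ ℚ.≤_)
      (solve 3 (λ q r d → r :+ d :- q := r :+ con (ℚ.- 1ℚ) :* q :+ d) refl q r δ) (0≤q-p q≤r+δ)

<⇒≤ : ∀ x y → x < y → x ≤ y
<⇒≤ x y (γ , 0<γ , K , gap) ε 0<ε = K , λ n n≥K → begin
  seq x n                 ≡⟨ ℚ.+-identityʳ (seq x n) ⟨
  seq x n ℚ.+ 0ℚ          ≤⟨ ℚ.+-monoʳ-≤ (seq x n) (ℚ.<⇒≤ 0<γ) ⟩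
  seq x n ℚ.+ γ           ≤⟨ gap n n≥K ⟩
  seq y n                 ≡⟨ ℚ.+-identityʳ (seq y n) ⟨
  seq y n ℚ.+ 0ℚ          ≤⟨ ℚ.+-monoʳ-≤ (seq y n) (ℚ.<⇒≤ 0<ε) ⟩
  seq y n ℚ.+ ε           ∎
  where open ℚ.≤-Reasoning

<⇒≱ : ∀ x y → x < y → ¬ y ≤ x
<⇒≱ x y (γ , 0<γ , gap) y≤x =
  -- With half the gap as tolerance, `x + 2δ ≤ y ≤ x + δ` at some index.
  let δ , 0<δ , 2δ≡γ = divide (ℚ.+-mono-< 0<1 0<1) 0<γ
      K , near       = eventually-both gap (y≤x δ 0<δ)
      x+γ≤y , y≤x+δ  = near K ℕ.≤-refl
  in ℚ.<-irrefl refl (begin-strict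
    seq x K ℚ.+ δ                  ≡⟨ ℚ.+-identityʳ (seq x K ℚ.+ δ) ⟨
    seq x K ℚ.+ δ ℚ.+ 0ℚ           <⟨ ℚ.+-monoʳ-< (seq x K ℚ.+ δ) 0<δ ⟩
    seq x K ℚ.+ δ ℚ.+ δ
      ≡⟨ solve 2 (λ x d → x :+ d :+ d := x :+ (con 1ℚ :+ con 1ℚ) :* d) refl (seq x K) δ ⟩
    seq x K ℚ.+ (1ℚ ℚ.+ 1ℚ) ℚ.* δ  ≡⟨ cong (seq x K ℚ.+_) 2δ≡γ ⟩
    seq x K ℚ.+ γ                  ≤⟨ ℚ.≤-trans x+γ≤y y≤x+δ ⟩
    seq x K ℚ.+ δ                  ∎)
  where open ℚ.≤-Reasoning
        open +-*-Solver

-- Both sequences stay within δ = ε/5 of their K-th terms, which are compared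
-- with slack 3δ: this leaves a slack of 5δ on one side and a gap of δ on the other.
≤-or-> : ∀ x y {ε} → 0ℚ ℚ.< ε → (∃ λ K → ∀ n → K ℕ.≤ n → seq x n ℚ.≤ seq y n ℚ.+ ε) ⊎ y < x
≤-or-> x y {ε} 0<ε =
  let δ , 0<δ , 5δ≡ε = divide {5ℚ} (ℚ.positive⁻¹ 5ℚ) 0<ε
      Kx , near-x    = eventually-near x 0<δ
      Ky , near-y    = eventually-near y 0<δ
      x≤K            = ℕ.m≤m⊔n Kx Ky
      y≤K            = ℕ.m≤n⊔m Kx Ky
  in compare (Kx ℕ.⊔ Ky) δ 0<δ 5δ≡ε
       (λ m n m≥K n≥K → near-x m n (ℕ.≤-trans x≤K m≥K) (ℕ.≤-trans x≤K n≥K))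
       (λ m n m≥K n≥K → near-y m n (ℕ.≤-trans y≤K m≥K) (ℕ.≤-trans y≤K n≥K))
  where
  open ℚ.≤-Reasoning
  open +-*-Solver
  3ℚ 5ℚ : ℚ
  3ℚ = ℤ.+ 3 ℚ./ 1
  5ℚ = ℤ.+ 5 ℚ./ 1
  compare : ∀ K δ → 0ℚ ℚ.< δ → 5ℚ ℚ.* δ ≡ ε →
            (∀ m n → K ℕ.≤ m → K ℕ.≤ n → seq x m ℚ.≤ seq x n ℚ.+ δ) →
            (∀ m n → K ℕ.≤ m → K ℕ.≤ n → seq y m ℚ.≤ seq y n ℚ.+ δ) →
            (∃ λ K → ∀ n → K ℕ.≤ n → seq x n ℚ.≤ seq y n ℚ.+ ε) ⊎ y < x
  compare K δ 0<δ 5δ≡ε near-x near-y with seq x K ℚ.≤? seq y K ℚ.+ 3ℚ ℚ.* δ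
  ... | yes h = inj₁ (K , λ n n≥K → begin
    seq x n
      ≤⟨ near-x n K n≥K ℕ.≤-refl ⟩
    seq x K ℚ.+ δ
      ≤⟨ ℚ.+-monoˡ-≤ δ (ℚ.≤-trans h (ℚ.+-monoˡ-≤ (3ℚ ℚ.* δ) (near-y K n ℕ.≤-refl n≥K))) ⟩
    seq y n ℚ.+ δ ℚ.+ 3ℚ ℚ.* δ ℚ.+ δ
      ≡⟨ solve 2 (λ y d → y :+ d :+ con 3ℚ :* d :+ d := y :+ con 5ℚ :* d) refl (seq y n) δ ⟩
    seq y n ℚ.+ 5ℚ ℚ.* δ
      ≡⟨ cong (seq y n ℚ.+_) 5δ≡ε ⟩
    seq y n ℚ.+ ε ∎)
  ... | no h = inj₂ (δ , 0<δ , K , λ n n≥K → begin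
    seq y n ℚ.+ δ
      ≤⟨ ℚ.+-monoˡ-≤ δ (near-y n K n≥K ℕ.≤-refl) ⟩
    seq y K ℚ.+ δ ℚ.+ δ
      ≡⟨ solve 2 (λ y d → y :+ d :+ d := y :+ con 3ℚ :* d :- d) refl (seq y K) δ ⟩
    seq y K ℚ.+ 3ℚ ℚ.* δ ℚ.- δ
      ≤⟨ ℚ.+-monoˡ-≤ (ℚ.- δ) (ℚ.≤-trans (ℚ.<⇒≤ (ℚ.≰⇒> h)) (near-x K n ℕ.≤-refl n≥K)) ⟩
    seq x n ℚ.+ δ ℚ.- δ
      ≡⟨ solve 2 (λ x d → x :+ d :- d := x) refl (seq x n) δ ⟩
    seq x n ∎)

-- At each ε, `≤-or->` gives either the required bound or `y < x`, and the latter contradicts the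
-- hypothesis. Classical reasoning is therefore available whenever the goal is an inequality.
≤-stable : ∀ x y → Stable (x ≤ y)
≤-stable x y ¬¬x≤y ε 0<ε =
  [ id , (λ y<x → contradiction (<⇒≱ y x y<x) ¬¬x≤y) ]′ (≤-or-> x y 0<ε)

≰⇒≥ : ∀ x y → ¬ x ≤ y → y ≤ x
≰⇒≥ x y x≰y ε 0<ε =
  [ id , (λ x<y → contradiction (<⇒≤ x y x<y) x≰y) ]′ (≤-or-> y x 0<ε)

≤-poset : Poset _ _ _
≤-poset = record
  { Carrier        = ℝ
  ; _≈_            = _≃_
  ; _≤_            = _≤_
  ; isPartialOrder = record
    { isPreorder = record
      { isEquivalence = record
        { refl  = λ {x} → ≤-refl x , ≤-refl x
        ; sym   = λ (x≤y , y≤x) → y≤x , x≤y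
        ; trans = λ {x} {y} {z} (x≤y , y≤x) (y≤z , z≤y) →
                    ≤-trans x y z x≤y y≤z , ≤-trans z y x z≤y y≤x
        }
      ; reflexive = proj₁
      ; trans     = λ {x} {y} {z} → ≤-trans x y z
      }
    ; antisym = _,_
    }
  }

module ≤-Reasoning = PosetReasoning ≤-poset

-- Minima of lists

minimum-≤ : ∀ s {xs x} → s IsMinimumOf xs → x ∈ xs → s ≤ x
minimum-≤ s {r ∷ rs} {x} (s≤m , _) x∈ = ≤-trans s (List.foldr _⊓_ r rs) x s≤m (foldr-≤ rs x∈)
  where
  foldr-≤ : ∀ rs {x} → x ∈ r ∷ rs → List.foldr _⊓_ r rs ≤ x
  foldr-≤ []        (here refl) = ≤-refl r
  -- The head `r` seeds the fold and so sits at its far end: it is reached by passing through the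
  -- whole list.
  foldr-≤ (q ∷ rs) {x} (here refl) = ≤-trans (q ⊓ m) m x
    (pointwise⇒≤ (q ⊓ m) m λ n → ℚ.p⊓q≤q (seq q n) (seq m n)) (foldr-≤ rs (here refl))
    where m = List.foldr _⊓_ r rs
  foldr-≤ (q ∷ rs)  (there (here refl)) =
    pointwise⇒≤ (q ⊓ m) q λ n → ℚ.p⊓q≤p (seq q n) (seq m n)
    where m = List.foldr _⊓_ r rs
  foldr-≤ (q ∷ rs) {x} (there (there x∈)) = ≤-trans (q ⊓ m) m x
    (pointwise⇒≤ (q ⊓ m) m λ n → ℚ.p⊓q≤q (seq q n) (seq m n)) (foldr-≤ rs (there x∈))
    where m = List.foldr _⊓_ r rs

≤-minimum : ∀ s z {xs} → s IsMinimumOf xs → (∀ x → x ∈ xs → z ≤ x) → z ≤ s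
≤-minimum s z {r ∷ rs} (_ , m≤s) z≤ = ≤-trans z (List.foldr _⊓_ r rs) s
  (≤-foldr rs (z≤ r (here refl)) (λ q q∈ → z≤ q (there q∈))) m≤s
  where
  ≤-foldr : ∀ rs → z ≤ r → (∀ q → q ∈ rs → z ≤ q) → z ≤ List.foldr _⊓_ r rs
  ≤-foldr []       z≤r z≤q = z≤r
  ≤-foldr (q ∷ rs) z≤r z≤q = ⊓-glb q (List.foldr _⊓_ r rs) z
    (z≤q q (here refl)) (≤-foldr rs z≤r λ p p∈ → z≤q p (there p∈))

-- Sums

∑-mono : ∀ {m} (f g : Fin m → ℝ) → (∀ i → f i ≤ g i) → ∑ f ≤ ∑ g
∑-mono {ℕ.zero}  f g f≤g = ≤-refl 0ℝ
∑-mono {ℕ.suc m} f g f≤g = +-mono-≤ (f Fin.zero) (g Fin.zero) (∑ (f ∘ Fin.suc)) (∑ (g ∘ Fin.suc))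
  (f≤g Fin.zero) (∑-mono (f ∘ Fin.suc) (g ∘ Fin.suc) (f≤g ∘ Fin.suc))

∑-cong : ∀ {m} (f g : Fin m → ℝ) → (∀ i → f i ≃ g i) → ∑ f ≃ ∑ g
∑-cong f g f≃g = ∑-mono f g (proj₁ ∘ f≃g) , ∑-mono g f (proj₂ ∘ f≃g)

*-congˡ : ∀ a x y → 0ℝ ≤ a → x ≃ y → a * x ≃ a * y
*-congˡ a x y 0≤a (x≤y , y≤x) = *-monoʳ-≤ a x y 0≤a x≤y , *-monoʳ-≤ a y x 0≤a y≤x

+-cong : ∀ x y u v → x ≃ y → u ≃ v → x + u ≃ y + v
+-cong x y u v (x≤y , y≤x) (u≤v , v≤u) = +-mono-≤ x y u v x≤y u≤v , +-mono-≤ y x v u y≤x v≤u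

-- In use `a` is the edge weight and `b` a quantity attached to edges; cut weights and weighted sums
-- of distances both take this form.
dot : ∀ {X : Set} → (X → ℝ) → (X → ℝ) → List X → ℝ
dot a b xs = ∑ˡ (List.map (λ x → a x * b x) xs)

dot-monoʳ : ∀ {X : Set} (a b c : X → ℝ) → (∀ x → 0ℝ ≤ a x) → (∀ x → b x ≤ c x) →
            ∀ xs → dot a b xs ≤ dot a c xs
dot-monoʳ a b c 0≤a b≤c []       = ≤-refl 0ℝ
dot-monoʳ a b c 0≤a b≤c (x ∷ xs) = +-mono-≤ (a x * b x) (a x * c x) (dot a b xs) (dot a c xs)
  (*-monoʳ-≤ (a x) (b x) (c x) (0≤a x) (b≤c x)) (dot-monoʳ a b c 0≤a b≤c xs)

dot-+ : ∀ {X : Set} (a b c : X → ℝ) xs → dot a b xs + dot a c xs ≃ dot a (λ x → b x + c x) xs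
dot-+ a b c xs = pointwise⇒≃ (dot a b xs + dot a c xs) (dot a (λ x → b x + c x) xs) λ n → go n xs
  where
  open +-*-Solver
  go : ∀ n xs → seq (dot a b xs) n ℚ.+ seq (dot a c xs) n ≡ seq (dot a (λ x → b x + c x) xs) n
  go n []       = refl
  go n (x ∷ xs) = trans
    (solve 5 (λ a b c p q → a :* b :+ p :+ (a :* c :+ q) := a :* (b :+ c) :+ (p :+ q)) refl
      (seq (a x) n) (seq (b x) n) (seq (c x) n) (seq (dot a b xs) n) (seq (dot a c xs) n))
    (cong (seq (a x) n ℚ.* (seq (b x) n ℚ.+ seq (c x) n) ℚ.+_) (go n xs))

sumℚ : ∀ {m} → (Fin m → ℚ) → ℚ
sumℚ = Vector.foldr ℚ._+_ 0ℚ

seq-∑ : ∀ {m} (f : Fin m → ℝ) n → seq (∑ f) n ≡ sumℚ (λ k → seq (f k) n)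
seq-∑ {ℕ.zero}  f n = refl
seq-∑ {ℕ.suc m} f n = cong (seq (f Fin.zero) n ℚ.+_) (seq-∑ (f ∘ Fin.suc) n)

sumℚ-zero : ∀ {m} (γ : Fin m → ℚ) → sumℚ (λ k → γ k ℚ.* 0ℚ) ≡ 0ℚ
sumℚ-zero {ℕ.zero}  γ = refl
sumℚ-zero {ℕ.suc m} γ = cong₂ ℚ._+_ (ℚ.*-zeroʳ (γ Fin.zero)) (sumℚ-zero (γ ∘ Fin.suc))

sumℚ-linear : ∀ {m} (γ u v : Fin m → ℚ) p → sumℚ (λ k → γ k ℚ.* (p ℚ.* u k ℚ.+ v k)) ≡
              p ℚ.* sumℚ (λ k → γ k ℚ.* u k) ℚ.+ sumℚ (λ k → γ k ℚ.* v k)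
sumℚ-linear {ℕ.zero}  γ u v p = sym (trans (ℚ.+-identityʳ (p ℚ.* 0ℚ)) (ℚ.*-zeroʳ p))
sumℚ-linear {ℕ.suc m} γ u v p = trans
  (cong (γ Fin.zero ℚ.* (p ℚ.* u Fin.zero ℚ.+ v Fin.zero) ℚ.+_)
    (sumℚ-linear (γ ∘ Fin.suc) (u ∘ Fin.suc) (v ∘ Fin.suc) p))
  (solve 6 (λ g u v p r s → g :* (p :* u :+ v) :+ (p :* r :+ s) := p :* (g :* u :+ r) :+ (g :* v :+ s))
    refl (γ Fin.zero) (u Fin.zero) (v Fin.zero) p
    (sumℚ λ k → γ (Fin.suc k) ℚ.* u (Fin.suc k)) (sumℚ λ k → γ (Fin.suc k) ℚ.* v (Fin.suc k)))
  where open +-*-Solver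

-- Interchange of the sum over `k` with the sum over the list. The hypothesis on `δ` is an identity
-- of sequence terms, so the computation is exact in ℚ at each index.
∑-dot : ∀ {m} {X : Set} (γ : Fin m → ℝ) (a : X → ℝ) (κ : Fin m → X → ℝ) (δ : X → ℝ) →
        (∀ x n → seq (δ x) n ≡ sumℚ (λ k → seq (γ k) n ℚ.* seq (κ k x) n)) →
        ∀ xs → ∑ (λ k → γ k * dot a (κ k) xs) ≃ dot a δ xs
∑-dot γ a κ δ δ≡ xs = pointwise⇒≃ (∑ λ k → γ k * dot a (κ k) xs) (dot a δ xs)
  λ n → trans (seq-∑ (λ k → γ k * dot a (κ k) xs) n) (go n xs)
  where
  open ≡-Reasoning
  go : ∀ n xs → sumℚ (λ k → seq (γ k) n ℚ.* seq (dot a (κ k) xs) n) ≡ seq (dot a δ xs) n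
  go n []       = sumℚ-zero (λ k → seq (γ k) n)
  go n (x ∷ xs) = begin
    sumℚ (λ k → seq (γ k) n ℚ.* (seq (a x) n ℚ.* seq (κ k x) n ℚ.+ seq (dot a (κ k) xs) n))
      ≡⟨ sumℚ-linear (λ k → seq (γ k) n) (λ k → seq (κ k x) n)
           (λ k → seq (dot a (κ k) xs) n) (seq (a x) n) ⟩
    seq (a x) n ℚ.* sumℚ (λ k → seq (γ k) n ℚ.* seq (κ k x) n) ℚ.+
    sumℚ (λ k → seq (γ k) n ℚ.* seq (dot a (κ k) xs) n)
      ≡⟨ cong₂ (λ p q → seq (a x) n ℚ.* p ℚ.+ q) (sym (δ≡ x n)) (go n xs) ⟩
    seq (a x) n ℚ.* seq (δ x) n ℚ.+ seq (dot a δ xs) n ∎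

-- Cuts

-- The indicator of `b` differing from `c`, written as in `dist`, so that a distance unfolds to a
-- weighted sum of gaps.
gap : Bool → Bool → ℝ
gap b c = natToℝ ℕ.∣ bit b - bit c ∣

crossing : ∀ {N} → (Fin N → Bool) → Edge N → ℝ
crossing b e = gap (b (lo e)) (b (hi e))

-- Filtering the edges amounts to giving each edge coefficient 1 or 0. The separate function `b`
-- lets sets built by `tabulate` or `zipWith` be replaced by the formula for their bits.
cutWeight-dot : ∀ {N} (w : WeightMap N) W (b : Fin N → Bool) → (∀ v → lookup W v ≡ b v) →
                cutWeight w W ≃ dot (weight w) (crossing b) (edges N)
cutWeight-dot {N} w W b W≗b =
  pointwise⇒≃ (cutWeight w W) (dot (weight w) (crossing b) (edges N)) λ n → go n (edges N)
  where
  ∈⇒true : ∀ {v} → v ∈ₛ W → b v ≡ true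
  ∈⇒true {v} v∈W = trans (sym (W≗b v)) ([]=⇒lookup v∈W)

  ∉⇒false : ∀ {v} → ¬ v ∈ₛ W → b v ≡ false
  ∉⇒false {v} v∉W = Bool.¬-not λ bv → v∉W (lookup⇒[]= v W (trans (W≗b v) bv))

  -- The sequence of a `gap` is constant, so its term at 0 serves for every index.
  gapℚ : Bool → Bool → ℚ
  gapℚ b c = seq (gap b c) 0

  cut : ∀ e → InCut W e → gapℚ (b (lo e)) (b (hi e)) ≡ 1ℚ
  cut e (inj₁ (lo∈ , hi∉)) = cong₂ gapℚ (∈⇒true lo∈) (∉⇒false hi∉)
  cut e (inj₂ (lo∉ , hi∈)) = cong₂ gapℚ (∉⇒false lo∉) (∈⇒true hi∈)

  uncut : ∀ e → ¬ InCut W e → gapℚ (b (lo e)) (b (hi e)) ≡ 0ℚ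
  uncut e ∉cut with lo e ∈? W | hi e ∈? W
  ... | yes lo∈ | yes hi∈ = cong₂ gapℚ (∈⇒true lo∈) (∈⇒true hi∈)
  ... | yes lo∈ | no hi∉  = contradiction (inj₁ (lo∈ , hi∉)) ∉cut
  ... | no lo∉  | yes hi∈ = contradiction (inj₂ (lo∉ , hi∈)) ∉cut
  ... | no lo∉  | no hi∉  = cong₂ gapℚ (∉⇒false lo∉) (∉⇒false hi∉)

  add-one : ∀ p {q r s} → q ≡ 1ℚ → r ≡ s → p ℚ.+ r ≡ p ℚ.* q ℚ.+ s
  add-one p refl refl = cong (ℚ._+ _) (sym (ℚ.*-identityʳ p))

  add-zero : ∀ p {q r s} → q ≡ 0ℚ → r ≡ s → r ≡ p ℚ.* q ℚ.+ s
  add-zero p {r = r} refl refl = sym (trans (cong (ℚ._+ r) (ℚ.*-zeroʳ p)) (ℚ.+-identityˡ r))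

  go : ∀ n es → seq (∑ˡ (List.map (weight w) (filter (inCut? W) es))) n ≡
       seq (dot (weight w) (crossing b) es) n
  go n [] = refl
  go n (e ∷ es) = step (inCut? W e)
    where
    total : List (Edge N) → ℚ
    total es = seq (∑ˡ (List.map (weight w) es)) n
    step : Dec (InCut W e) → total (filter (inCut? W) (e ∷ es)) ≡
           seq (dot (weight w) (crossing b) (e ∷ es)) n
    step (yes e∈) = trans (cong total (filter-accept (inCut? W) e∈))
      (add-one (seq (weight w e) n) (cut e e∈) (go n es))
    step (no e∉)  = trans (cong total (filter-reject (inCut? W) e∉))
      (add-zero (seq (weight w e) n) (uncut e e∉) (go n es))

-- Double counting: an edge uv lies in the k-th cut exactly when `z u` and `z v` differ at k, so
-- over all k it contributes its weight times the distance between `z u` and `z v`.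
∑-cutWeight : ∀ {m N} (γ : Fin m → ℝ) (w : WeightMap N) (W : Fin m → Subset N)
              (z : Fin N → Vec Bool m) →
              (∀ k → 0ℝ ≤ γ k) → (∀ k v → lookup (W k) v ≡ lookup (z v) k) →
              ∑ (λ k → γ k * cutWeight w (W k)) ≃
              dot (weight w) (λ e → dist γ (z (lo e)) (z (hi e))) (edges N)
∑-cutWeight {m} {N} γ w W z 0≤γ W≗z = begin-equality
  ∑ (λ k → γ k * cutWeight w (W k))
    ≈⟨ ∑-cong (λ k → γ k * cutWeight w (W k))
         (λ k → γ k * dot (weight w) (crossing (b k)) (edges N))
         (λ k → *-congˡ (γ k) (cutWeight w (W k)) (dot (weight w) (crossing (b k)) (edges N))
           (0≤γ k)
           (cutWeight-dot w (W k) (b k) (W≗z k))) ⟩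
  ∑ (λ k → γ k * dot (weight w) (crossing (b k)) (edges N))
    ≈⟨ ∑-dot γ (weight w) (λ k → crossing (b k)) (λ e → dist γ (z (lo e)) (z (hi e)))
         (λ e → seq-∑ λ k →
           γ k * natToℝ ℕ.∣ bit (lookup (z (lo e)) k) - bit (lookup (z (hi e)) k) ∣)
         (edges N) ⟩
  dot (weight w) (λ e → dist γ (z (lo e)) (z (hi e))) (edges N) ∎
  where
  open ≤-Reasoning
  b : Fin m → Fin N → Bool
  b k v = lookup (z v) k

∀Bool? : ∀ {P : Bool → Set} → (∀ b → Dec (P b)) → Dec (∀ b → P b)
∀Bool? P? = map′ (λ (p , q) → λ { true → p ; false → q }) (λ p → p true , p false)
                 (P? true ×-dec P? false)

-- For (∧ , ∨) this is submodularity of cuts, for the two differences posimodularity;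
-- the sequences are constant, so the index 0 is immaterial.
Uncrosses : (g h : Bool → Bool → Bool) → Set
Uncrosses g h = ∀ a b c d →
  seq (gap (g a b) (g c d) + gap (h a b) (h c d)) 0 ℚ.≤ seq (gap a c + gap b d) 0

-- Only four bits are involved, so evaluating sixteen rational comparisons settles the question.
uncrosses? : ∀ g h → Dec (Uncrosses g h)
uncrosses? g h = ∀Bool? λ a → ∀Bool? λ b → ∀Bool? λ c → ∀Bool? λ d → _ ℚ.≤? _

∧-∨-uncrosses : Uncrosses _∧_ _∨_
∧-∨-uncrosses = from-yes (uncrosses? _∧_ _∨_)

∖-∖-uncrosses : Uncrosses (λ a b → a ∧ not b) (λ a b → not a ∧ b)
∖-∖-uncrosses = from-yes (uncrosses? (λ a b → a ∧ not b) (λ a b → not a ∧ b))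

-- `Uncrosses` gives the inequality on each single edge; nonnegative weights allow summation.
cutWeight-uncross : ∀ {N} (w : WeightMap N) g h → Uncrosses g h → ∀ A B →
                    cutWeight w (zipWith g A B) + cutWeight w (zipWith h A B) ≤
                    cutWeight w A + cutWeight w B
cutWeight-uncross {N} w g h uncrosses A B = begin
  cutWeight w (zipWith g A B) + cutWeight w (zipWith h A B)
    ≈⟨ +-cong (cutWeight w (zipWith g A B)) (c (crossing g[A,B]))
               (cutWeight w (zipWith h A B)) (c (crossing h[A,B]))
         (cutWeight-dot w (zipWith g A B) g[A,B] λ v → lookup-zipWith g v A B)
         (cutWeight-dot w (zipWith h A B) h[A,B] λ v → lookup-zipWith h v A B) ⟩
  c (crossing g[A,B]) + c (crossing h[A,B])
    ≈⟨ dot-+ (weight w) (crossing g[A,B]) (crossing h[A,B]) (edges N) ⟩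
  c (λ e → crossing g[A,B] e + crossing h[A,B] e)
    ≤⟨ dot-monoʳ (weight w) (λ e → crossing g[A,B] e + crossing h[A,B] e)
         (λ e → crossing (lookup A) e + crossing (lookup B) e) (nonneg w)
         (λ e → pointwise⇒≤ (crossing g[A,B] e + crossing h[A,B] e)
                             (crossing (lookup A) e + crossing (lookup B) e)
           λ _ → uncrosses (lookup A (lo e)) (lookup B (lo e)) (lookup A (hi e)) (lookup B (hi e)))
         (edges N) ⟩
  c (λ e → crossing (lookup A) e + crossing (lookup B) e)
    ≈⟨ dot-+ (weight w) (crossing (lookup A)) (crossing (lookup B)) (edges N) ⟨
  c (crossing (lookup A)) + c (crossing (lookup B))
    ≈⟨ +-cong (cutWeight w A) (c (crossing (lookup A))) (cutWeight w B) (c (crossing (lookup B)))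
         (cutWeight-dot w A (lookup A) λ _ → refl) (cutWeight-dot w B (lookup B) λ _ → refl) ⟨
  cutWeight w A + cutWeight w B ∎
  where
  open ≤-Reasoning
  g[A,B] h[A,B] : Fin N → Bool
  g[A,B] v = g (lookup A v) (lookup B v)
  h[A,B] v = h (lookup A v) (lookup B v)
  c : (Edge N → ℝ) → ℝ
  c χ = dot (weight w) χ (edges N)

-- Finite subsets and least elements

∈-subsets : ∀ {N} (W : Subset N) → W ∈ subsets N
∈-subsets []                      = here refl
∈-subsets {ℕ.suc N} (outside ∷ W) = ∈-++⁺ˡ (∈-map⁺ (outside ∷_) (∈-subsets W))
∈-subsets {ℕ.suc N} (inside ∷ W)  =
  ∈-++⁺ʳ (List.map (outside ∷_) (subsets N)) (∈-map⁺ (inside ∷_) (∈-subsets W))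

lookup-truncate : ∀ {X : Set} {m n} (m≤n : m ℕ.≤ n) (xs : Vec X n) i →
                  lookup (truncate m≤n xs) i ≡ lookup xs (inject≤ i m≤n)
lookup-truncate (ℕ.s≤s m≤n) (x ∷ xs) Fin.zero    = refl
lookup-truncate (ℕ.s≤s m≤n) (x ∷ xs) (Fin.suc i) = lookup-truncate m≤n xs i

lookup-injective : ∀ {X : Set} {n} (xs ys : Vec X n) → (∀ i → lookup xs i ≡ lookup ys i) → xs ≡ ys
lookup-injective xs ys eq =
  trans (sym (tabulate∘lookup xs)) (trans (tabulate-cong eq) (tabulate∘lookup ys))

⊆∧∣∣≥⇒⊇ : ∀ {n} {p q : Subset n} → p ⊆ q → ∣ q ∣ ℕ.≤ ∣ p ∣ → q ⊆ p
⊆∧∣∣≥⇒⊇ {p = p} p⊆q q≤p {x} x∈q with x ∈? p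
... | yes x∈p = x∈p
... | no x∉p  = contradiction (p⊂q⇒∣p∣<∣q∣ (p⊆q , x , x∈q , x∉p)) (ℕ.≤⇒≯ q≤p)

-- Totality is known only up to double negation, so the induction on the list runs in that monad;
-- reflexivity is totality at a repeated element.
¬¬-least : ∀ {X : Set} (_≲_ : X → X → Set) → (∀ {x y z} → x ≲ y → y ≲ z → x ≲ z) →
           (∀ x y → ¬ ¬ (x ≲ y ⊎ y ≲ x)) → ∀ x xs →
           ¬ ¬ (∃ λ m → m ∈ x ∷ xs × (∀ y → y ∈ x ∷ xs → m ≲ y))
¬¬-least _≲_ ≲-trans total = go
  where
  open RawMonad (¬¬-Monad {Level.zero})
  ≲-refl : ∀ x → ¬ ¬ (x ≲ x)
  ≲-refl x = [ id , id ]′ <$> total x x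

  Least : List _ → Set
  Least xs = ∃ λ m → m ∈ xs × (∀ y → y ∈ xs → m ≲ y)

  extend : ∀ {x xs} → x ≲ x → (l : Least xs) → x ≲ proj₁ l ⊎ proj₁ l ≲ x → Least (x ∷ xs)
  extend x≲x (m , m∈ , m≲) (inj₁ x≲m) =
    _ , here refl , λ { _ (here refl) → x≲x ; y (there y∈) → ≲-trans x≲m (m≲ y y∈) }
  extend x≲x (m , m∈ , m≲) (inj₂ m≲x) =
    m , there m∈ , λ { _ (here refl) → m≲x ; y (there y∈) → m≲ y y∈ }

  go : ∀ x xs → ¬ ¬ Least (x ∷ xs)
  go x []       = (λ x≲x → x , here refl , λ { _ (here refl) → x≲x }) <$> ≲-refl x
  go x (y ∷ xs) = do
    x≲x ← ≲-refl x
    l   ← go y xs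
    t   ← total x (proj₁ l)
    pure (extend x≲x l t)

-- Admissible cuts and least cuts

module _ {n M} (n<N : n ℕ.< ℕ.suc M) where

  vertex : Label n → Fin (ℕ.suc M)
  vertex (terminal i) = inject≤ i (ℕ.<⇒≤ n<N)
  vertex sink         = fromℕ M

  -- One condition over all labels covers both clauses of admissibility: `occurs sink K` is `false`,
  -- so at `sink` it says that `W` avoids the sink.
  admissible⁺ : ∀ K W → (∀ i → lookup W (vertex i) ≡ occurs i K) → Admissible n<N K W
  admissible⁺ K W W≗K =
    (λ sink∈W → contradiction (trans (sym ([]=⇒lookup sink∈W)) (W≗K sink)) λ ()) ,
    lookup-injective (truncate (ℕ.<⇒≤ n<N) W) K
      (λ i → trans (lookup-truncate (ℕ.<⇒≤ n<N) W i) (W≗K (terminal i)))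

  admissible⁻ : ∀ K W → Admissible n<N K W → ∀ i → lookup W (vertex i) ≡ occurs i K
  admissible⁻ K W (sink∉W , W≡K) (terminal i) =
    trans (sym (lookup-truncate (ℕ.<⇒≤ n<N) W i)) (cong (λ p → lookup p i) W≡K)
  admissible⁻ K W (sink∉W , W≡K) sink = Bool.¬-not λ e → sink∉W (lookup⇒[]= (fromℕ M) W e)

  admissibleCuts : Subset n → List (Subset (ℕ.suc M))
  admissibleCuts K = filter (admissible? n<N K) (subsets (ℕ.suc M))

  ∈-admissibleCuts : ∀ K W → Admissible n<N K W → W ∈ admissibleCuts K
  ∈-admissibleCuts K W = ∈-filter⁺ (admissible? n<N K) (∈-subsets W)

module _ {n M} (n<N : n ℕ.< ℕ.suc M) (w : WeightMap (ℕ.suc M)) where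

  -- Lexicographic by weight and cardinality, stated without deciding whether weights are equal.
  _≲_ : Subset (ℕ.suc M) → Subset (ℕ.suc M) → Set
  U ≲ V = cutWeight w U ≤ cutWeight w V × (cutWeight w V ≤ cutWeight w U → ∣ U ∣ ℕ.≤ ∣ V ∣)

  -- If `W` is no heavier than `U`, the chain of weights closes into a cycle, so the cardinality
  -- clauses of both hypotheses apply.
  ≲-trans : ∀ {U V W} → U ≲ V → V ≲ W → U ≲ W
  ≲-trans {U} {V} {W} (U≤V , ∣U∣≤∣V∣) (V≤W , ∣V∣≤∣W∣) =
    ≤-trans (cutWeight w U) (cutWeight w V) (cutWeight w W) U≤V V≤W , λ W≤U → ℕ.≤-trans
      (∣U∣≤∣V∣ (≤-trans (cutWeight w V) (cutWeight w W) (cutWeight w U) V≤W W≤U))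
      (∣V∣≤∣W∣ (≤-trans (cutWeight w W) (cutWeight w U) (cutWeight w V) W≤U U≤V))

  -- Under double negation both weight comparisons may be decided. They cannot both fail, by `≰⇒≥`,
  -- and cardinality breaks a tie.
  ≲-total : ∀ U V → ¬ ¬ (U ≲ V ⊎ V ≲ U)
  ≲-total U V = compare <$> ¬¬-excluded-middle <*> ¬¬-excluded-middle
    where
    open RawMonad (¬¬-Monad {Level.zero})
    compare : Dec (cutWeight w U ≤ cutWeight w V) → Dec (cutWeight w V ≤ cutWeight w U) →
              U ≲ V ⊎ V ≲ U
    compare (yes U≤V) (yes V≤U) =
      Sum.map (λ le → U≤V , λ _ → le) (λ le → V≤U , λ _ → le) (ℕ.≤-total ∣ U ∣ ∣ V ∣)
    compare (yes U≤V) (no V≰U)  = inj₁ (U≤V , λ V≤U → contradiction V≤U V≰U)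
    compare (no U≰V)  (yes V≤U) = inj₂ (V≤U , λ U≤V → contradiction U≤V U≰V)
    compare (no U≰V)  (no V≰U)  = contradiction (≰⇒≥ (cutWeight w U) (cutWeight w V) U≰V) V≰U

  IsLeastCut : Subset n → Subset (ℕ.suc M) → Set
  IsLeastCut K W = Admissible n<N K W × (∀ V → Admissible n<N K V → W ≲ V)

  ¬¬-leastCut : ∀ K s → s IsMinimumOf List.map (cutWeight w) (admissibleCuts n<N K) →
                ¬ ¬ (∃ λ W → IsLeastCut K W)
  ¬¬-leastCut K s s-min = ¬¬-map
    (λ (W , W∈ , W≲) → W , proj₂ (∈-filter⁻ (admissible? n<N K) {xs = subsets (ℕ.suc M)} W∈) ,
                       λ V V-adm → W≲ V (∈-admissibleCuts n<N K V V-adm))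
    (go (admissibleCuts n<N K) s-min)
    where
    go : ∀ Ws → s IsMinimumOf List.map (cutWeight w) Ws →
         ¬ ¬ (∃ λ W → W ∈ Ws × (∀ V → V ∈ Ws → W ≲ V))
    -- An empty list has no minimum, so `s` being one guarantees an admissible cut to start from.
    go (W ∷ Ws) _ = ¬¬-least _≲_ (λ {U} {V} {W} → ≲-trans {U} {V} {W}) ≲-total W Ws

  minimum-≤-cut : ∀ K V s → s IsMinimumOf List.map (cutWeight w) (admissibleCuts n<N K) →
                  Admissible n<N K V → s ≤ cutWeight w V
  minimum-≤-cut K V s s-min V-adm =
    minimum-≤ s s-min (∈-map⁺ (cutWeight w) (∈-admissibleCuts n<N K V V-adm))

  leastCut-≤-minimum : ∀ K W s → s IsMinimumOf List.map (cutWeight w) (admissibleCuts n<N K) →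
                       IsLeastCut K W → cutWeight w W ≤ s
  leastCut-≤-minimum K W s s-min (_ , W≲) = ≤-minimum s (cutWeight w W) s-min λ x x∈ →
    let V , V∈ , x≡V = ∈-map⁻ (cutWeight w) x∈
        _ , V-adm    = ∈-filter⁻ (admissible? n<N K) {xs = subsets (ℕ.suc M)} V∈
    in subst (cutWeight w W ≤_) (sym x≡V) (proj₁ (W≲ V V-adm))

  -- B costs no more than h A B, so uncrossing makes g A B at most as heavy as A;
  -- as |A| is least, A is contained in g A B.
  leastCut-uncross : ∀ g h → Uncrosses g h → (∀ b c → g b c ≡ true → b ≡ true) →
                     ∀ K L A B → IsLeastCut K A → IsLeastCut L B →
                     (∀ i → g (occurs i K) (occurs i L) ≡ occurs i K) →
                     (∀ i → h (occurs i K) (occurs i L) ≡ occurs i L) →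
                     ∀ v → lookup A v ≡ true → g true (lookup B v) ≡ true
  leastCut-uncross g h uncrosses g⊆ K L A B (A-adm , A≲) (B-adm , B≲) g≗K h≗L v Av = begin
    g true (lookup B v)          ≡⟨ cong (λ b → g b (lookup B v)) Av ⟨
    g (lookup A v) (lookup B v)  ≡⟨ lookup-zipWith g v A B ⟨
    lookup (zipWith g A B) v     ≡⟨ []=⇒lookup (⊆∧∣∣≥⇒⊇ gAB⊆A ∣A∣≤∣gAB∣ (lookup⇒[]= v A Av)) ⟩
    true                         ∎
    where
    open ≡-Reasoning
    combined : ∀ k i → lookup (zipWith k A B) (vertex n<N i) ≡ k (occurs i K) (occurs i L)
    combined k i = trans (lookup-zipWith k (vertex n<N i) A B)
      (cong₂ k (admissible⁻ n<N K A A-adm i) (admissible⁻ n<N L B B-adm i))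

    gAB⊆A : zipWith g A B ⊆ A
    gAB⊆A {u} u∈ = lookup⇒[]= u A (g⊆ _ _ (trans (sym (lookup-zipWith g u A B)) ([]=⇒lookup u∈)))

    gAB≤A : cutWeight w (zipWith g A B) ≤ cutWeight w A
    gAB≤A = +-cancel-≤
      (cutWeight w (zipWith g A B)) (cutWeight w A) (cutWeight w (zipWith h A B)) (cutWeight w B)
      (cutWeight-uncross w g h uncrosses A B)
      (proj₁ (B≲ (zipWith h A B)
        (admissible⁺ n<N L (zipWith h A B) λ i → trans (combined h i) (h≗L i))))

    ∣A∣≤∣gAB∣ : ∣ A ∣ ℕ.≤ ∣ zipWith g A B ∣
    ∣A∣≤∣gAB∣ = proj₂
      (A≲ (zipWith g A B)
        (admissible⁺ n<N K (zipWith g A B) λ i → trans (combined g i) (g≗K i)))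
      gAB≤A

-- The domain element of a vertex

∧-trueˡ : ∀ b c → b ∧ c ≡ true → b ≡ true
∧-trueˡ true c _ = refl

occurs-∩ : ∀ {n} {K L : Subset n} i → occurs i K ≡ true → occurs i L ≡ true → Nonempty (K ∩ L)
occurs-∩ {K = K} {L} (terminal i) i∈K i∈L = i , x∈p∩q⁺ (lookup⇒[]= i K i∈K , lookup⇒[]= i L i∈L)

occurs-⊆ : ∀ {n} {K L : Subset n} → K ⊆ L → ∀ i → occurs i K ≡ true → occurs i L ≡ true
occurs-⊆ {K = K} K⊆L (terminal i) i∈K = []=⇒lookup (K⊆L (lookup⇒[]= i K i∈K))

-- Applied at every label with `b` for K and `c` for L: if K and L are disjoint, the two differences
-- of a cut for K and a cut for L are again cuts for K and for L.
∖-disjoint : ∀ b c → (b ≡ true → c ≡ true → ⊥) → b ∧ not c ≡ b × not b ∧ c ≡ c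
∖-disjoint true  true  ¬bc = ⊥-elim (¬bc refl refl)
∖-disjoint true  false ¬bc = refl , refl
∖-disjoint false c     ¬bc = refl , refl

-- The analogue for K contained in L: the intersection is a cut for K and the union a cut for L.
∧-∨-ordered : ∀ b c → (b ≡ true → c ≡ true) → b ∧ c ≡ b × b ∨ c ≡ c
∧-∨-ordered true  c b⇒c = b⇒c refl , sym (b⇒c refl)
∧-∨-ordered false c b⇒c = refl , refl

vec-injective : ∀ {n L} {I : Fin L → NonemptySubset n} {x y : A I} → vec x ≡ vec y → x ≡ y
vec-injective {x = mkA _ _ _} {mkA _ _ _} refl = refl

module _ {n M} (n<N : n ℕ.< ℕ.suc M) (w : WeightMap (ℕ.suc M)) {L} (I : Fin L → NonemptySubset n)
         (W : Fin L → Subset (ℕ.suc M)) (W-least : ∀ l → IsLeastCut n<N w (set (I l)) (W l)) where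

  bits : Fin (ℕ.suc M) → Vec Bool L
  bits v = tabulate λ l → lookup (W l) v

  ∈-bits : ∀ v {l} → l ∈ₛ bits v → lookup (W l) v ≡ true
  ∈-bits v {l} l∈ = trans (sym (lookup∘tabulate (λ l → lookup (W l) v) l)) ([]=⇒lookup l∈)

  -- If `I l` and `I k` were disjoint, uncrossing by the two differences would keep `W l` off `W k`,
  -- yet `v` lies in both. Nonemptiness is decidable, which permits the argument by contradiction.
  bits-intersecting : ∀ v → PairwiseIntersecting I (bits v)
  bits-intersecting v l k l∈ k∈ = decidable-stable (nonempty? (set (I l) ∩ set (I k))) λ ¬meet →
    let disjoint = λ i → ∖-disjoint (occurs i (set (I l))) (occurs i (set (I k)))
                           λ i∈l i∈k → ¬meet (occurs-∩ i i∈l i∈k)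
    in contradiction
      (trans (sym (cong not (∈-bits v k∈)))
        (leastCut-uncross n<N w (λ b c → b ∧ not c) (λ b c → not b ∧ c) ∖-∖-uncrosses
          (λ b c → ∧-trueˡ b (not c))
          (set (I l)) (set (I k)) (W l) (W k) (W-least l) (W-least k)
          (λ i → proj₁ (disjoint i)) (λ i → proj₂ (disjoint i)) v (∈-bits v l∈)))
      λ ()

  -- Uncrossing by intersection and union places `W l` inside `W k`.
  bits-upper : ∀ v → UpperSet I (bits v)
  bits-upper v l k l∈ Il⊆Ik = lookup⇒[]= k (bits v) (trans
    (lookup∘tabulate (λ l → lookup (W l) v) k)
    (leastCut-uncross n<N w _∧_ _∨_ ∧-∨-uncrosses ∧-trueˡ
      (set (I l)) (set (I k)) (W l) (W k) (W-least l) (W-least k)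
      (λ i → proj₁ (ordered i)) (λ i → proj₂ (ordered i)) v (∈-bits v l∈)))
    where
    ordered : ∀ i → occurs i (set (I l)) ∧ occurs i (set (I k)) ≡ occurs i (set (I l)) ×
                    occurs i (set (I l)) ∨ occurs i (set (I k)) ≡ occurs i (set (I k))
    ordered i = ∧-∨-ordered (occurs i (set (I l))) (occurs i (set (I k))) (occurs-⊆ Il⊆Ik i)

  point : Fin (ℕ.suc M) → A I
  point v = mkA (bits v) (bits-intersecting v) (bits-upper v)

  -- Each `W l` is a cut for `I l`, so at the vertex of a label its bits are the occurrence bits.
  -- This is where the prescribed values of the contraction become applicable.
  point-vertex : ∀ i → point (vertex n<N i) ≡ occurrenceA I i
  point-vertex i = vec-injective
    (tabulate-cong λ l → admissible⁻ n<N (set (I l)) (W l) (proj₁ (W-least l)) i)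

-- From the contraction to the inequality

theorem4 : ∀ (n : ℕ) → 1 ℕ.≤ n → (Q : CanonicalInequality n) →
    (∃ λ (f : A (I Q) → Vec Bool (R Q)) → IsContraction Q f × RespectsOccurrences Q f) →
    Valid Q
theorem4 n _ Q (f , contraction , respects) S (M , n<N , w , realizes) =
  -- The goal is stable, so least cuts, which exist only up to double negation, may be chosen; as
  -- there are finitely many indices, the choices can be made simultaneously.
  ≤-stable (∑ λ r → β r * S (J r)) (∑ λ l → α l * S (I Q l)) (¬¬-map bound
    (Fin.sequence (RawMonad.rawApplicative (¬¬-Monad {Level.zero}))
      λ l → ¬¬-leastCut n<N w (set (I Q l)) (S (I Q l)) (realizes (I Q l))))
  where
  open CanonicalInequality Q using (L; α; β; J; α-pos; β-pos; Satisfies)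
  open ≤-Reasoning

  bound : (∀ l → ∃ λ W → IsLeastCut n<N w (set (I Q l)) W) → Satisfies S
  bound least = begin
    ∑ (λ r → β r * S (J r))
      ≤⟨ ∑-mono (λ r → β r * S (J r)) (λ r → β r * cutWeight w (U r)) (λ r →
           *-monoʳ-≤ (β r) (S (J r)) (cutWeight w (U r)) (<⇒≤ 0ℝ (β r) (β-pos r))
             (minimum-≤-cut n<N w (set (J r)) (U r) (S (J r)) (realizes (J r)) (U-admissible r))) ⟩
    ∑ (λ r → β r * cutWeight w (U r))
      ≈⟨ ∑-cutWeight β w U (λ v → f (z v)) (λ r → <⇒≤ 0ℝ (β r) (β-pos r))
           (λ r v → lookup∘tabulate (λ v → lookup (f (z v)) r) v) ⟩
    dot (weight w) (λ e → dist β (f (z (lo e))) (f (z (hi e)))) (edges (ℕ.suc M))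
      ≤⟨ dot-monoʳ (weight w) (λ e → dist β (f (z (lo e))) (f (z (hi e))))
           (λ e → dist α (vec (z (lo e))) (vec (z (hi e))))
           (nonneg w) (λ e → contraction (z (lo e)) (z (hi e))) (edges (ℕ.suc M)) ⟩
    dot (weight w) (λ e → dist α (vec (z (lo e))) (vec (z (hi e)))) (edges (ℕ.suc M))
      ≈⟨ ∑-cutWeight α w W (λ v → vec (z v)) (λ l → <⇒≤ 0ℝ (α l) (α-pos l))
           (λ l v → sym (lookup∘tabulate (λ l → lookup (W l) v) l)) ⟨
    ∑ (λ l → α l * cutWeight w (W l))
      ≤⟨ ∑-mono (λ l → α l * cutWeight w (W l)) (λ l → α l * S (I Q l)) (λ l →
           *-monoʳ-≤ (α l) (cutWeight w (W l)) (S (I Q l)) (<⇒≤ 0ℝ (α l) (α-pos l))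
             (leastCut-≤-minimum n<N w (set (I Q l)) (W l) (S (I Q l))
               (realizes (I Q l)) (proj₂ (least l)))) ⟩
    ∑ (λ l → α l * S (I Q l)) ∎
    where
    W : Fin L → Subset (ℕ.suc M)
    W l = proj₁ (least l)

    z : Fin (ℕ.suc M) → A (I Q)
    z = point n<N w (I Q) W (λ l → proj₂ (least l))

    U : Fin (R Q) → Subset (ℕ.suc M)
    U r = tabulate λ v → lookup (f (z v)) r

    -- At the vertex of label `i`, `z` takes the value `x^(i)`, which `f` sends to `y^(i)`; its r-th
    -- bit tells whether `i` belongs to `J r`.
    U-admissible : ∀ r → Admissible n<N (set (J r)) (U r)
    U-admissible r = admissible⁺ n<N (set (J r)) (U r) λ i →
      trans (lookup∘tabulate (λ v → lookup (f (z v)) r) (vertex n<N i))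
        (trans (cong (λ x → lookup (f x) r) (point-vertex n<N w (I Q) W (λ l → proj₂ (least l)) i))
          (trans (cong (λ y → lookup y r) (respects i))
            (lookup∘tabulate (λ r → occurs i (set (J r))) r)))
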